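{- For all integers $n\ge 2$, $k\ge 1$ and $t\ge 1$, $\pi_t(P_n^{(k)})=p_t(n,k)$.
   Context: For positive integers $n,k$, $P_n^{(k)}$ is the graph with vertices $v_1,\dots,v_n$ in which $v_i\sim v_j$ iff $1\le |i-j|\le k$. For $n\ge 2$ put $d=\lfloor (n-2)/k\rfloor+1$, $b=(n-2)-k(d-1)$, and $p_t(n,k)=\max\{t2^d+b,\ 2t+n-2\}$. A configuration on a graph $G$ is $C:V(G)\to\mathbb{N}$ of size $|C|=\sum_vC(v)$; a pebbling step from a vertex with at least two pebbles to a neighbor removes two pebbles from the first and adds one to the second. $C$ is $t$-fold $r$-solvable if some sequence of pebbling steps places at least $t$ pebbles on $r$; $\pi_t(G,r)$ is the least $m$ such that every configuration of size $m$ is $t$-fold $r$-solvable; $\pi_t(G)=\max_{r}\pi_t(G,r)$. -}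

module Defs where

open import Data.Nat using (ℕ; zero; suc; _+_; _*_; _∸_; _^_; _≤_; _<_; _⊔_; ∣_-_∣; NonZero)
open import Data.Nat.DivMod using (_/_)
open import Data.Fin using (Fin; toℕ; _≟_)
open import Data.Vec using (sum; tabulate)
open import Data.Product using (Σ; ∃; _×_)
open import Relation.Nullary using (¬_; yes; no)
open import Relation.Binary.PropositionalEquality using (_≡_)
open import Relation.Binary.Construct.Closure.ReflexiveTransitive using (Star)

Graph : ℕ → Set₁
Graph n = Fin n → Fin n → Set

Pk : (n k : ℕ) → Graph n
Pk n k i j = 1 ≤ ∣ toℕ i - toℕ j ∣ × ∣ toℕ i - toℕ j ∣ ≤ k

Config : ℕ → Set
Config n = Fin n → ℕ

size : ∀ {n} → Config n → ℕ
size {n} C = sum (tabulate C)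

at : ∀ {n} → Fin n → Fin n → ℕ → ℕ
at x y c with x ≟ y
... | yes _ = c
... | no  _ = 0

data Step {n} (G : Graph n) (C : Config n) : Config n → Set where
  step : (u w : Fin n) → G u w → 2 ≤ C u →
         (C' : Config n) →
         (∀ x → C' x ≡ (C x ∸ at x u 2) + at x w 1) →
         Step G C C'

Reach : ∀ {n} → Graph n → Config n → Config n → Set
Reach G = Star (Step G)

Solvable : ∀ {n} → Graph n → ℕ → Fin n → Config n → Set
Solvable G t r C = ∃ λ C' → Reach G C C' × t ≤ C' r

AllSolvable : ∀ {n} → Graph n → ℕ → Fin n → ℕ → Set
AllSolvable {n} G t r m = (C : Config n) → size C ≡ m → Solvable G t r C

IsRootedPebblingNumber : ∀ {n} → Graph n → ℕ → Fin n → ℕ → Set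
IsRootedPebblingNumber G t r m =
  AllSolvable G t r m × (∀ m' → m' < m → ¬ AllSolvable G t r m')

IsPebblingNumber : ∀ {n} → Graph n → ℕ → ℕ → Set
IsPebblingNumber {n} G t p =
  ((r : Fin n) → ∃ λ m → IsRootedPebblingNumber G t r m × m ≤ p)
  × (∃ λ r → IsRootedPebblingNumber G t r p)

dPar : (n k : ℕ) → .{{NonZero k}} → ℕ
dPar n k = (n ∸ 2) / k + 1

bPar : (n k : ℕ) → .{{NonZero k}} → ℕ
bPar n k = (n ∸ 2) ∸ k * (dPar n k ∸ 1)

pt : (t n k : ℕ) → .{{NonZero k}} → ℕ
pt t n k = (t * 2 ^ dPar n k + bPar n k) ⊔ (2 * t + n ∸ 2)

{-# OPTIONS --safe #-}
module Submission where

-- Upper bound. List the root, the vertices on one side of it and then those on the other side as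
-- positions 0, ..., N = n - 1: whenever w < v ≤ w + k, a pebble can move from v to w or, better, to
-- the root. Walk along the list with a
-- first-in-first-out queue of demands for one pebble, initially t of them at 0. At v each pair of
-- pebbles satisfies the oldest demand, a leftover pebble replaces the oldest demand by one at v, and a
-- demand at v - k that is still pending expires: it is replaced by two demands at v. Let q(v) and o(v)
-- be the numbers of pending demands and of pebbles up to v. If no demand expires at v, then
-- q(v) = q(v-1) in the absence of pairs; if one does, every demand pending at v - k has just been
-- processed, so q(v) = 2 q(v-k) - (o(v) - o(v-k)). Either way, the bounds
-- o(v) + q(v) 2^(j+1) + (N - 1 - v - k j) ≤ B for all j with k j ≤ N - 1 - v are propagated, and at
-- the end they say that the pile at N serves all remaining demands. At v = 0 they read
-- t 2^(j+1) + (n - 2 - k j) ≤ B, and by convexity in j only j = 0 and j = d - 1 matter: these are the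
-- two terms of p_t(n,k).
--
-- Lower bound. With the root at one end, put t 2^(j+1) - 1 pebbles on the other end and one on every
-- other vertex at distance more than k j from the root. A potential that counts only pairs of pebbles
-- on these vertices never increases and stays below t 2^(j+1). Again j = 0 and j = d - 1 suffice.

open import Defs
open import Data.Fin using (Fin; zero; suc; toℕ; fromℕ; fromℕ<; _≟_)
open import Data.Fin.Permutation using (Permutation; permutation; _⟨$⟩ʳ_)
open import Data.Fin.Properties using (any?; toℕ-fromℕ; toℕ-fromℕ<; toℕ-injective; toℕ≤pred[n])
open import Data.List using (List; []; _∷_; _++_; length; replicate)
open import Data.List.Properties using (length-++; length-replicate)
open import Data.Nat hiding (_≟_)
open import Data.Nat.Divisibility using (∣-refl)
open import Data.Nat.DivMod
open import Data.Nat.Properties hiding (_≟_)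
open import Algebra.Properties.CommutativeMonoid.Sum +-0-commutativeMonoid
  using (sum-permute) renaming (sum to vsum)
open import Data.Nat.Tactic.RingSolver using (solve-∀)
open import Data.Product using (∃; _×_; _,_; proj₁; proj₂)
open import Data.Sum using (_⊎_; inj₁; inj₂)
open import Data.Vec.Functional using () renaming (_∷_ to _∷ᶠ_; [] to []ᶠ)
open import Function using (_∘_)
open import Relation.Binary.Construct.Closure.ReflexiveTransitive using (ε; _◅_)
open import Relation.Binary.PropositionalEquality hiding (J)
open import Relation.Nullary using (¬_; Dec; yes; no; contradiction)
open import Relation.Nullary.Decidable using (_×-dec_; map′)

-- Point masses, sizes and single moves.

module _ {n : ℕ} where

  at-same : ∀ (x : Fin n) c → at x x c ≡ c
  at-same x c with x ≟ x
  ... | yes _   = refl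
  ... | no  x≢x = contradiction refl x≢x

  at-other : ∀ {x y : Fin n} → x ≢ y → ∀ c → at x y c ≡ 0
  at-other {x} {y} x≢y c with x ≟ y
  ... | yes x≡y = contradiction x≡y x≢y
  ... | no  _   = refl

  at-+ : ∀ (x y : Fin n) a b → at x y (a + b) ≡ at x y a + at x y b
  at-+ x y a b with x ≟ y
  ... | yes _ = refl
  ... | no  _ = refl

  at-mono : ∀ (x y : Fin n) {a b} → a ≤ b → at x y a ≤ at x y b
  at-mono x y a≤b with x ≟ y
  ... | yes _ = a≤b
  ... | no  _ = z≤n

  at≤ : ∀ (x y : Fin n) c → at x y c ≤ c
  at≤ x y c with x ≟ y
  ... | yes _ = ≤-refl
  ... | no  _ = z≤n

  at-≤-pointwise : ∀ (x y : Fin n) {c} (C : Config n) → c ≤ C y → at x y c ≤ C x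
  at-≤-pointwise x y C c≤Cy with x ≟ y
  ... | yes refl = c≤Cy
  ... | no  _    = z≤n

size-cong : ∀ {n} {C D : Config n} → (∀ x → C x ≡ D x) → size C ≡ size D
size-cong {zero}  C≗D = refl
size-cong {suc n} C≗D = cong₂ _+_ (C≗D zero) (size-cong (C≗D ∘ suc))

size-mono : ∀ {n} {C D : Config n} → (∀ x → C x ≤ D x) → size C ≤ size D
size-mono {zero}  C≤D = z≤n
size-mono {suc n} C≤D = +-mono-≤ (C≤D zero) (size-mono (C≤D ∘ suc))

+-swap : ∀ a b c → a + b + c ≡ a + c + b
+-swap = solve-∀

+-interchange : ∀ a b c d → (a + b) + (c + d) ≡ (a + c) + (b + d)
+-interchange = solve-∀

size-+ : ∀ {n} (C D : Config n) → size (λ x → C x + D x) ≡ size C + size D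
size-+ {zero}  C D = refl
size-+ {suc n} C D =
  trans (cong (C zero + D zero +_) (size-+ (C ∘ suc) (D ∘ suc))) (+-interchange (C zero) (D zero) _ _)

size-zero : ∀ n → size {n} (λ _ → 0) ≡ 0
size-zero zero    = refl
size-zero (suc n) = size-zero n

size-at : ∀ {n} (u : Fin n) c → size (λ x → at x u c) ≡ c
size-at {suc n} zero c =
  trans (cong₂ _+_ (at-same {suc n} zero c) (trans (size-cong {n} (λ x → at-other {x = suc x} {zero} (λ ()) c)) (size-zero n)))
        (+-identityʳ c)
size-at {suc n} (suc u) c =
  cong₂ _+_ (at-other {suc n} {zero} {suc u} (λ ()) c) (trans (size-cong shift) (size-at u c))
  where
  shift : ∀ x → at (suc x) (suc u) c ≡ at x u c
  shift x with x ≟ u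
  ... | yes _ = refl
  ... | no  _ = refl

C≤size : ∀ {n} (C : Config n) x → C x ≤ size C
C≤size C zero    = m≤m+n _ _
C≤size C (suc x) = ≤-trans (C≤size (C ∘ suc) x) (m≤n+m _ _)

-- A lower bound concerns every smaller size, so an extremal configuration has to be thinned out to
-- each of them.
size-≤-subconfig : ∀ {n} (C : Config n) {m} → m ≤ size C →
                   ∃ λ C' → (∀ x → C' x ≤ C x) × size C' ≡ m
size-≤-subconfig {zero}  C z≤n = C , (λ ()) , refl
size-≤-subconfig {suc n} C {m} m≤ with size-≤-subconfig (C ∘ suc) {m ∸ C zero} (m≤n+o⇒m∸n≤o m (C zero) m≤)
... | C' , C'≤C , eq = (m ⊓ C zero) ∷ᶠ C' ,
  (λ { zero → m⊓n≤n m (C zero) ; (suc x) → C'≤C x }) ,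
  trans (cong (m ⊓ C zero +_) eq) (trans (cong (_+ (m ∸ C zero)) (⊓-comm m (C zero))) (m⊓n+n∸m≡n (C zero) m))

module _ {n : ℕ} (C : Config n) (u w : Fin n) where

  move : Config n
  move x = (C x ∸ at x u 2) + at x w 1

  -- Avoids truncated subtraction: later comparisons add the two pebbles back and cancel.
  move-balance : 2 ≤ C u → ∀ x → move x + at x u 2 ≡ C x + at x w 1
  move-balance 2≤Cu x = begin
    (C x ∸ at x u 2) + at x w 1 + at x u 2   ≡⟨ +-swap (C x ∸ at x u 2) (at x w 1) (at x u 2) ⟩
    (C x ∸ at x u 2) + at x u 2 + at x w 1   ≡⟨ cong (_+ at x w 1) (m∸n+n≡m (at-≤-pointwise x u C 2≤Cu)) ⟩
    C x + at x w 1                           ∎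
    where
    open ≡-Reasoning

  size-move : 2 ≤ C u → suc (size move) ≡ size C
  size-move 2≤Cu = suc-injective (begin
    suc (suc (size move))                      ≡⟨ +-comm 2 (size move) ⟩
    size move + 2                              ≡⟨ cong (size move +_) (size-at u 2) ⟨
    size move + size (λ x → at x u 2)          ≡⟨ size-+ move (λ x → at x u 2) ⟨
    size (λ x → move x + at x u 2)             ≡⟨ size-cong (move-balance 2≤Cu) ⟩
    size (λ x → C x + at x w 1)                ≡⟨ size-+ C (λ x → at x w 1) ⟩
    size C + size (λ x → at x w 1)             ≡⟨ cong (size C +_) (size-at w 1) ⟩
    size C + 1                                 ≡⟨ +-comm (size C) 1 ⟩
    suc (size C)                               ∎)
    where open ≡-Reasoning

-- Monotonicity and decidability of solvability.

module _ {n : ℕ} {G : Graph n} {t : ℕ} {r : Fin n} where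

  -- Trading one pebble anywhere for one on the root: as soon as a step needs the missing pebble, the
  -- token v just follows the pebble that this step would have produced.
  trade-for-root : ∀ {A A'} → Reach G A A' → t ≤ A' r → ∀ B v →
                   (∀ x → A x + at x r 1 ≤ B x + at x v 1) → Solvable G t r B
  trade-for-root {A} ε t≤ B v A≤B = B , ε , +-cancelʳ-≤ 1 t (B r) (begin
    t + 1             ≤⟨ +-monoˡ-≤ 1 t≤ ⟩
    A r + 1           ≡⟨ cong (A r +_) (at-same r 1) ⟨
    A r + at r r 1    ≤⟨ A≤B r ⟩
    B r + at r v 1    ≤⟨ +-monoʳ-≤ (B r) (at≤ r v 1) ⟩
    B r + 1           ∎)
    where open ≤-Reasoning
  trade-for-root {A} (step u w uw 2≤Au A₁ A₁≡ ◅ A₁⟶A') t≤ B v A≤B with 2 ≤? B u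
  ... | yes 2≤Bu = let B' , B₁⟶B' , t≤B' = trade-for-root A₁⟶A' t≤ (move B u w) v moved
                   in B' , step u w uw 2≤Bu _ (λ _ → refl) ◅ B₁⟶B' , t≤B'
    where
    open ≤-Reasoning
    moved : ∀ x → A₁ x + at x r 1 ≤ move B u w x + at x v 1
    moved x = +-cancelʳ-≤ (at x u 2) _ _ (begin
      A₁ x + at x r 1 + at x u 2        ≡⟨ +-swap (A₁ x) (at x r 1) (at x u 2) ⟩
      A₁ x + at x u 2 + at x r 1        ≡⟨ cong (λ a → a + at x u 2 + at x r 1) (A₁≡ x) ⟩
      move A u w x + at x u 2 + at x r 1 ≡⟨ cong (_+ at x r 1) (move-balance A u w 2≤Au x) ⟩
      A x + at x w 1 + at x r 1         ≡⟨ +-swap (A x) (at x w 1) (at x r 1) ⟩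
      A x + at x r 1 + at x w 1         ≤⟨ +-monoˡ-≤ (at x w 1) (A≤B x) ⟩
      B x + at x v 1 + at x w 1         ≡⟨ +-swap (B x) (at x v 1) (at x w 1) ⟩
      B x + at x w 1 + at x v 1         ≡⟨ cong (_+ at x v 1) (move-balance B u w 2≤Bu x) ⟨
      move B u w x + at x u 2 + at x v 1 ≡⟨ +-swap (move B u w x) (at x u 2) (at x v 1) ⟩
      move B u w x + at x v 1 + at x u 2 ∎)
  ... | no 2≰Bu = trade-for-root A₁⟶A' t≤ B w followed
    where
    open ≤-Reasoning
    Au≤ : A u + at u r 1 ≤ suc (B u)
    Au≤ = begin
      A u + at u r 1 ≤⟨ A≤B u ⟩
      B u + at u v 1 ≤⟨ +-monoʳ-≤ (B u) (at≤ u v 1) ⟩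
      B u + 1        ≡⟨ +-comm (B u) 1 ⟩
      suc (B u)      ∎
    -- Only at `v` can `B` have fewer pebbles than `A`, so a step open to `A` alone starts at `v`.
    u≡v : u ≡ v
    u≡v with u ≟ v
    ... | yes p = p
    ... | no u≢v = contradiction (begin
      2              ≤⟨ 2≤Au ⟩
      A u            ≤⟨ m≤m+n (A u) (at u r 1) ⟩
      A u + at u r 1 ≤⟨ A≤B u ⟩
      B u + at u v 1 ≡⟨ cong (B u +_) (at-other u≢v 1) ⟩
      B u + 0        ≡⟨ +-identityʳ (B u) ⟩
      B u            ∎) 2≰Bu
    -- At `u`, `A` exceeds `B` by at most one, which is less than the two pebbles that leave.
    kept : ∀ x → (A x ∸ at x u 2) + at x r 1 ≤ B x
    kept x with x ≟ u
    ... | yes refl = +-cancelʳ-≤ 2 _ _ (begin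
      (A x ∸ 2) + at x r 1 + 2   ≡⟨ +-swap (A x ∸ 2) (at x r 1) 2 ⟩
      (A x ∸ 2) + 2 + at x r 1   ≡⟨ cong (_+ at x r 1) (m∸n+n≡m 2≤Au) ⟩
      A x + at x r 1             ≤⟨ Au≤ ⟩
      suc (B x)                  ≤⟨ n≤1+n _ ⟩
      2 + B x                    ≡⟨ +-comm 2 (B x) ⟩
      B x + 2                    ∎)
    ... | no x≢u = begin
      A x + at x r 1   ≤⟨ A≤B x ⟩
      B x + at x v 1   ≡⟨ cong (B x +_) (at-other (λ x≡v → x≢u (trans x≡v (sym u≡v))) 1) ⟩
      B x + 0          ≡⟨ +-identityʳ (B x) ⟩
      B x              ∎
    followed : ∀ x → A₁ x + at x r 1 ≤ B x + at x w 1
    followed x = begin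
      A₁ x + at x r 1                              ≡⟨ cong (_+ at x r 1) (A₁≡ x) ⟩
      (A x ∸ at x u 2) + at x w 1 + at x r 1       ≡⟨ +-swap (A x ∸ at x u 2) (at x w 1) (at x r 1) ⟩
      (A x ∸ at x u 2) + at x r 1 + at x w 1       ≤⟨ +-monoˡ-≤ (at x w 1) (kept x) ⟩
      B x + at x w 1                               ∎

  -- The trade with `v = r`, where the same pebble is added on both sides.
  solvable-mono : ∀ {A B} → (∀ x → A x ≤ B x) → Solvable G t r A → Solvable G t r B
  solvable-mono {B = B} A≤B (A' , A⟶A' , t≤) = trade-for-root A⟶A' t≤ B r (λ x → +-monoˡ-≤ (at x r 1) (A≤B x))

  -- Each step costs one pebble, so a search of depth `s` is exhaustive.
  solvable? : (∀ u w → Dec (G u w)) → ∀ s C → size C ≤ s → Dec (Solvable G t r C)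
  solvable? G? s C size≤ with t ≤? C r
  ... | yes t≤ = yes (C , ε , t≤)
  solvable? G? zero C size≤ | no t≰ = no λ
    { (_ , ε , t≤) → t≰ t≤
    ; (_ , step u _ _ 2≤ _ _ ◅ _ , _) → contradiction (≤-trans 2≤ (≤-trans (C≤size C u) size≤)) λ () }
  solvable? G? (suc s) C size≤ | no t≰ = map′ from to (any? λ u → any? λ w → after? u w)
    where
    After : Fin n → Fin n → Set
    After u w = (G u w × 2 ≤ C u) × Solvable G t r (move C u w)
    after? : ∀ u w → Dec (After u w)
    after? u w with G? u w ×-dec (2 ≤? C u)
    ... | no ¬p = no (¬p ∘ proj₁)
    ... | yes (uw , 2≤) with solvable? G? s (move C u w)
                               (s≤s⁻¹ (≤-trans (≤-reflexive (size-move C u w 2≤)) size≤))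
    ... | yes sol = yes ((uw , 2≤) , sol)
    ... | no ¬sol = no (¬sol ∘ proj₂)
    from : (∃ λ u → ∃ λ w → After u w) → Solvable G t r C
    from (u , w , (uw , 2≤) , C' , C⟶ , t≤) = C' , step u w uw 2≤ _ (λ _ → refl) ◅ C⟶ , t≤
    to : Solvable G t r C → ∃ λ u → ∃ λ w → After u w
    to (_ , ε , t≤) = contradiction t≤ t≰
    -- `C₁` is only pointwise equal to `move C u w`; monotonicity stands in for function
    -- extensionality.
    to (C' , step u w uw 2≤ C₁ C₁≡ ◅ C₁⟶ , t≤) =
      u , w , (uw , 2≤) , solvable-mono (≤-reflexive ∘ C₁≡) (C' , C₁⟶ , t≤)

-- Recursion on the first pile, which is at most `m`. A configuration is rebuilt from its head and
-- tail only up to pointwise equality, hence `ext`.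
allOfSize? : ∀ n (P : Config n → Set) → (∀ {C D} → (∀ x → C x ≡ D x) → P C → P D) →
             (∀ C → Dec (P C)) → ∀ m → Dec (∀ C → size C ≡ m → P C)
allOfSize? zero P ext P? zero = map′ (λ p C _ → ext {[]ᶠ} (λ ()) p) (λ all → all []ᶠ refl) (P? []ᶠ)
allOfSize? zero P ext P? (suc m) = yes λ C ()
allOfSize? (suc n) P ext P? m = map′ from to (allUpTo? first? (suc m))
  where
  First : ℕ → Set
  First c = ∀ C → size C ≡ m ∸ c → P (c ∷ᶠ C)
  first? : ∀ c → Dec (First c)
  first? c = allOfSize? n (λ C → P (c ∷ᶠ C)) (λ C≗D → ext λ { zero → refl ; (suc x) → C≗D x })
                        (λ C → P? (c ∷ᶠ C)) (m ∸ c)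
  from : (∀ {c} → c < suc m → First c) → ∀ C → size C ≡ m → P C
  from all C refl = ext (λ { zero → refl ; (suc x) → refl })
    (all {C zero} (s≤s (m≤m+n _ _)) (C ∘ suc) (sym (m+n∸m≡n (C zero) _)))
  to : (∀ C → size C ≡ m → P C) → ∀ {c} → c < suc m → First c
  to all {c} (s≤s c≤m) C eq = all (c ∷ᶠ C) (trans (cong (c +_) eq) (m+[n∸m]≡n c≤m))

allSolvable? : ∀ {n} (G : Graph n) → (∀ u w → Dec (G u w)) → ∀ t r m → Dec (AllSolvable G t r m)
allSolvable? G G? t r = allOfSize? _ (Solvable G t r) (λ C≗D → solvable-mono (≤-reflexive ∘ C≗D))
                                     (λ C → solvable? G? (size C) C ≤-refl)

module _ {P : ℕ → Set} (P? : ∀ m → Dec (P m)) where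

  leastBelow : ∀ b → (∃ λ m → (P m × (∀ m' → m' < m → ¬ P m')) × m < b) ⊎ (∀ m → m < b → ¬ P m)
  leastBelow zero = inj₂ λ _ ()
  leastBelow (suc b) with leastBelow b
  ... | inj₁ (m , least , m<b) = inj₁ (m , least , m<n⇒m<1+n m<b)
  ... | inj₂ none with P? b
  ...   | yes p = inj₁ (b , (p , none) , ≤-refl)
  ...   | no ¬p = inj₂ λ m m<1+b p → split (m≤n⇒m<n∨m≡n (s≤s⁻¹ m<1+b)) p
    where
    split : ∀ {m} → m < b ⊎ m ≡ b → ¬ P m
    split (inj₁ m<b)  = none _ m<b
    split (inj₂ refl) = ¬p

  -- Supplies the rooted pebbling number at roots for which just an upper bound `b` is at hand.
  least : ∀ {b} → P b → ∃ λ m → (P m × (∀ m' → m' < m → ¬ P m')) × m ≤ b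
  least {b} p with leastBelow (suc b)
  ... | inj₁ (m , min , m<1+b) = m , min , s≤s⁻¹ m<1+b
  ... | inj₂ none              = contradiction p (none b ≤-refl)

-- Lower bound by a potential.

module Potential {n : ℕ} (G : Graph n) (irreflexive : ∀ u → ¬ G u u)
  (φ : Fin n → ℕ → ℕ) (gain loss : Fin n → ℕ)
  (φ-gain : ∀ x c → φ x (1 + c) ≤ φ x c + gain x)
  (φ-loss : ∀ x c → φ x c + loss x ≤ φ x (2 + c))
  (gain≤loss : ∀ {u w} → G u w → gain w ≤ loss u) where

  potential : Config n → ℕ
  potential C = size (λ x → φ x (C x))

  -- `φ` changes only at the two ends, which differ by irreflexivity: it drops by at least `loss u`
  -- at one and grows by at most `gain w` at the other. It need not be linear, so single pebbles can
  -- count for nothing.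
  step-decreases : ∀ {C C'} → Step G C C' → potential C' ≤ potential C
  step-decreases {C} (step u w uw 2≤ C' C'≡) = +-cancelʳ-≤ (loss u) _ _ (begin
    potential C' + loss u                                   ≡⟨ cong (potential C' +_) (size-at u (loss u)) ⟨
    potential C' + size (λ x → at x u (loss u))             ≡⟨ size-+ (λ x → φ x (C' x)) (λ x → at x u (loss u)) ⟨
    size (λ x → φ x (C' x) + at x u (loss u))               ≤⟨ size-mono pointwise ⟩
    size (λ x → φ x (C x) + at x w (gain w))                ≡⟨ size-+ (λ x → φ x (C x)) (λ x → at x w (gain w)) ⟩
    potential C + size (λ x → at x w (gain w))              ≡⟨ cong (potential C +_) (size-at w (gain w)) ⟩
    potential C + gain w                                    ≤⟨ +-monoʳ-≤ (potential C) (gain≤loss uw) ⟩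
    potential C + loss u                                    ∎)
    where
    open ≤-Reasoning
    pointwise : ∀ x → φ x (C' x) + at x u (loss u) ≤ φ x (C x) + at x w (gain w)
    pointwise x with x ≟ u | x ≟ w | C'≡ x
    ... | yes refl | yes refl | _  = contradiction uw (irreflexive u)
    ... | yes refl | no _     | eq = begin
      φ x (C' x) + loss x        ≡⟨ cong (λ c → φ x c + loss x) (trans eq (+-identityʳ _)) ⟩
      φ x (C x ∸ 2) + loss x     ≤⟨ φ-loss x (C x ∸ 2) ⟩
      φ x (2 + (C x ∸ 2))        ≡⟨ cong (φ x) (m+[n∸m]≡n 2≤) ⟩
      φ x (C x)                  ≡⟨ +-identityʳ _ ⟨
      φ x (C x) + 0              ∎
    ... | no _     | yes refl | eq = begin
      φ x (C' x) + 0             ≡⟨ +-identityʳ _ ⟩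
      φ x (C' x)                 ≡⟨ cong (φ x) (trans eq (+-comm (C x) 1)) ⟩
      φ x (1 + C x)              ≤⟨ φ-gain x (C x) ⟩
      φ x (C x) + gain x         ∎
    ... | no _     | no _     | eq =
      ≤-reflexive (cong (λ c → φ x c + 0) (trans eq (+-identityʳ _)))

  reach-decreases : ∀ {C C'} → Reach G C C' → potential C' ≤ potential C
  reach-decreases ε        = ≤-refl
  reach-decreases (s ◅ ss) = ≤-trans (reach-decreases ss) (step-decreases s)

  solvable⇒potential : ∀ {t r C} → Solvable G t r C → ∃ λ c → t ≤ c × φ r c ≤ potential C
  solvable⇒potential {r = r} (C' , C⟶C' , t≤) =
    C' r , t≤ , ≤-trans (C≤size (λ x → φ x (C' x)) r) (reach-decreases C⟶C')

beyond : ∀ {n} → ℕ → Config n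
beyond K x with K <? toℕ x
... | yes _ = 1
... | no  _ = 0

size-beyond : ∀ n K → size {n} (beyond K) ≡ n ∸ suc K
size-beyond zero    K       = refl
size-beyond (suc n) zero    = all-ones n
  where
  all-ones : ∀ n → size {n} (λ x → beyond zero (suc x)) ≡ n
  all-ones zero    = refl
  all-ones (suc n) = cong suc (all-ones n)
size-beyond (suc n) (suc K) = trans (size-cong shift) (size-beyond n K)
  where
  shift : ∀ (x : Fin n) → beyond (suc K) (suc x) ≡ beyond K x
  shift x with K <? toℕ x | suc K <? suc (toℕ x)
  ... | yes _ | yes _ = refl
  ... | no _  | no _  = refl
  ... | yes p | no ¬q = contradiction (s≤s p) ¬q
  ... | no ¬p | yes q = contradiction (s≤s⁻¹ q) ¬p

double-half≤ : ∀ c → 2 * ⌊ c /2⌋ ≤ c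
double-half≤ zero          = z≤n
double-half≤ (suc zero)    = z≤n
double-half≤ (suc (suc c)) = begin
  2 * suc ⌊ c /2⌋     ≡⟨ *-suc 2 ⌊ c /2⌋ ⟩
  2 + 2 * ⌊ c /2⌋     ≤⟨ +-monoʳ-≤ 2 (double-half≤ c) ⟩
  2 + c               ∎
  where open ≤-Reasoning

⌊1+n/2⌋≤1+⌊n/2⌋ : ∀ n → ⌊ suc n /2⌋ ≤ suc ⌊ n /2⌋
⌊1+n/2⌋≤1+⌊n/2⌋ zero          = z≤n
⌊1+n/2⌋≤1+⌊n/2⌋ (suc zero)    = s≤s z≤n
⌊1+n/2⌋≤1+⌊n/2⌋ (suc (suc n)) = s≤s (⌊1+n/2⌋≤1+⌊n/2⌋ n)

m≤n+o : ∀ {k} m n → ∣ m - n ∣ ≤ k → m ≤ n + k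
m≤n+o m n d = ≤-trans (m≤n+∣m-n∣ m n) (+-monoʳ-≤ n d)

module LowerBound (k J M : ℕ) .{{_ : NonZero k}} (Jk≤M : J * k ≤ M) (t : ℕ) (1≤t : 1 ≤ t) where

  -- Up to J k a pebble has the weight it would have on a geodesic to vertex 0; beyond J k only pairs
  -- of pebbles on one vertex count.
  φ′ : (i : ℕ) → Dec (i ≤ J * k) → ℕ → ℕ
  φ′ i (yes _) c = 2 ^ (1 + (J * k ∸ i) / k) * c
  φ′ i (no _)  c = 2 * ⌊ c /2⌋

  gain′ loss′ : (i : ℕ) → Dec (i ≤ J * k) → ℕ
  gain′ i (yes _) = 2 ^ (1 + (J * k ∸ i) / k)
  gain′ i (no _)  = 2
  loss′ i (yes _) = 2 * 2 ^ (1 + (J * k ∸ i) / k)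
  loss′ i (no _)  = 2

  n : ℕ
  n = 2 + M

  near? : (x : Fin n) → Dec (toℕ x ≤ J * k)
  near? x = toℕ x ≤? J * k

  φ : Fin n → ℕ → ℕ
  φ x = φ′ (toℕ x) (near? x)

  φ-gain : ∀ i d c → φ′ i d (1 + c) ≤ φ′ i d c + gain′ i d
  φ-gain i (yes _) c = ≤-reflexive (trans (*-suc W c) (+-comm W _))
    where W = 2 ^ (1 + (J * k ∸ i) / k)
  φ-gain i (no _) c = begin
    2 * ⌊ suc c /2⌋     ≤⟨ *-monoʳ-≤ 2 (⌊1+n/2⌋≤1+⌊n/2⌋ c) ⟩
    2 * suc ⌊ c /2⌋     ≡⟨ *-suc 2 ⌊ c /2⌋ ⟩
    2 + 2 * ⌊ c /2⌋     ≡⟨ +-comm 2 _ ⟩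
    2 * ⌊ c /2⌋ + 2     ∎
    where open ≤-Reasoning

  φ-loss : ∀ i d c → φ′ i d c + loss′ i d ≤ φ′ i d (2 + c)
  φ-loss i (yes _) c = ≤-reflexive (eq (2 ^ (1 + (J * k ∸ i) / k)) c)
    where
    eq : ∀ W c → W * c + 2 * W ≡ W * (2 + c)
    eq = solve-∀
  φ-loss i (no _) c = ≤-reflexive (eq ⌊ c /2⌋)
    where
    eq : ∀ h → 2 * h + 2 ≡ 2 * (1 + h)
    eq = solve-∀

  2≤loss : ∀ i d → 2 ≤ loss′ i d
  2≤loss i (yes _) = *-monoʳ-≤ 2 (m^n>0 2 (1 + (J * k ∸ i) / k))
  2≤loss i (no _)  = ≤-refl

  -- An edge leads at most `k` closer to vertex 0, so the exponent at `j` exceeds that at `i` by at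
  -- most one.
  gain≤loss : ∀ i j di dj → i ≤ j + k → gain′ j dj ≤ loss′ i di
  gain≤loss i j di      (no _)  i≤j+k = 2≤loss i di
  gain≤loss i j (yes _) (yes _) i≤j+k = ^-monoʳ-≤ 2 (s≤s (begin
    (J * k ∸ j) / k          ≤⟨ /-monoˡ-≤ k bound ⟩
    (k + (J * k ∸ i)) / k    ≡⟨ +-distrib-/-∣ˡ (J * k ∸ i) ∣-refl ⟩
    k / k + (J * k ∸ i) / k  ≡⟨ cong (_+ (J * k ∸ i) / k) (n/n≡1 k) ⟩
    1 + (J * k ∸ i) / k      ∎))
    where
    open ≤-Reasoning
    bound : J * k ∸ j ≤ k + (J * k ∸ i)
    bound = m≤n+o⇒m∸n≤o (J * k) j (begin
      J * k                        ≤⟨ m≤n+m∸n (J * k) i ⟩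
      i + (J * k ∸ i)              ≤⟨ +-monoˡ-≤ _ i≤j+k ⟩
      j + k + (J * k ∸ i)          ≡⟨ +-assoc j k _ ⟩
      j + (k + (J * k ∸ i))        ∎)
  -- Since `i` lies beyond `J * k`, `j` is less than `k` short of `J * k`, and a pebble there weighs
  -- exactly 2.
  gain≤loss i j (no i≰) (yes _) i≤j+k =
    ≤-reflexive (cong (λ e → 2 ^ (1 + e)) (m<n⇒m/n≡0 (m<n+o⇒m∸n<o (J * k) j (≤-trans (≰⇒> i≰) i≤j+k))))

  irreflexive : ∀ u → ¬ Pk n k u u
  irreflexive u (1≤ , _) = contradiction (≤-trans 1≤ (≤-reflexive (∣n-n∣≡0 (toℕ u)))) λ ()

  open Potential (Pk n k) irreflexive φ (λ x → gain′ (toℕ x) (near? x)) (λ x → loss′ (toℕ x) (near? x))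
    (λ x → φ-gain (toℕ x) (near? x)) (λ x → φ-loss (toℕ x) (near? x))
    (λ {u} {w} uw → gain≤loss (toℕ u) (toℕ w) (near? u) (near? w) (m≤n+o (toℕ u) (toℕ w) (proj₂ uw)))

  -- The potential of `t` pebbles on vertex 0.
  T : ℕ
  T = t * 2 ^ suc J

  2≤T : 2 ≤ T
  2≤T = begin
    2               ≤⟨ *-monoʳ-≤ 2 (m^n>0 2 J) ⟩
    2 ^ suc J       ≡⟨ *-identityˡ _ ⟨
    1 * 2 ^ suc J   ≤⟨ *-monoˡ-≤ (2 ^ suc J) 1≤t ⟩
    T               ∎
    where open ≤-Reasoning

  φ-root : ∀ c → φ zero c ≡ c * 2 ^ suc J
  φ-root c = trans (cong (λ e → 2 ^ suc e * c) (m*n/n≡m J k)) (*-comm (2 ^ suc J) c)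

  -- `beyond` already puts one pebble on the last vertex, so the pile there is `T ∸ 1`.
  extremal : Config n
  extremal x = beyond (J * k) x + at x (fromℕ (suc M)) (T ∸ 2)

  size-extremal : suc (size extremal) ≡ T + (M ∸ J * k)
  size-extremal = begin
    suc (size extremal)                                         ≡⟨ cong suc (size-+ (beyond (J * k)) (λ x → at x (fromℕ (suc M)) (T ∸ 2))) ⟩
    suc (size {n} (beyond (J * k)) + size (λ x → at x (fromℕ (suc M)) (T ∸ 2)))
                                                                ≡⟨ cong₂ (λ a b → suc (a + b)) (size-beyond n (J * k)) (size-at (fromℕ (suc M)) (T ∸ 2)) ⟩
    suc ((suc M ∸ J * k) + (T ∸ 2))                             ≡⟨ cong (λ a → suc (a + (T ∸ 2))) (+-∸-assoc 1 Jk≤M) ⟩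
    2 + ((M ∸ J * k) + (T ∸ 2))                                 ≡⟨ cong (2 +_) (+-comm (M ∸ J * k) (T ∸ 2)) ⟩
    2 + (T ∸ 2) + (M ∸ J * k)                                   ≡⟨ cong (_+ (M ∸ J * k)) (m+[n∸m]≡n 2≤T) ⟩
    T + (M ∸ J * k)                                             ∎
    where open ≡-Reasoning

  φ′-mono : ∀ i d {a b} → a ≤ b → φ′ i d a ≤ φ′ i d b
  φ′-mono i (yes _) a≤b = *-monoʳ-≤ (2 ^ (1 + (J * k ∸ i) / k)) a≤b
  φ′-mono i (no _)  a≤b = *-monoʳ-≤ 2 (⌊n/2⌋-mono a≤b)

  -- Vertices up to `J * k` are empty and a single pebble forms no pair, so only the pile counts.
  φ-extremal : ∀ x → φ x (extremal x) ≤ at x (fromℕ (suc M)) (T ∸ 1)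
  φ-extremal x with x ≟ fromℕ (suc M)
  φ-extremal x | yes refl with toℕ (fromℕ (suc M)) ≤? J * k | J * k <? toℕ (fromℕ (suc M))
  ... | yes p | _     = contradiction (≤-trans (subst (_≤ J * k) (toℕ-fromℕ (suc M)) p) Jk≤M) (<-irrefl refl)
  ... | no ¬p | no ¬q = contradiction (≰⇒> ¬p) ¬q
  ... | no _  | yes _ = ≤-trans (double-half≤ _) (≤-reflexive (sym (+-∸-assoc 1 2≤T)))
  φ-extremal x | no _ with toℕ x ≤? J * k | J * k <? toℕ x
  ... | yes p | yes q = contradiction (≤-trans q p) (<-irrefl refl)
  ... | yes _ | no _  = ≤-reflexive (*-zeroʳ (2 ^ (1 + (J * k ∸ toℕ x) / k)))
  ... | no _  | yes _ = z≤n
  ... | no _  | no _  = z≤n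

  ¬allSolvable : ∀ m → m < T + (M ∸ J * k) → ¬ AllSolvable (Pk n k) t zero m
  ¬allSolvable m m< all with size-≤-subconfig extremal {m} (s≤s⁻¹ (≤-trans m< (≤-reflexive (sym size-extremal))))
  ... | C , C≤ , eq with solvable⇒potential (all C eq)
  ... | c , t≤c , φc≤ = contradiction (begin-strict
    T                                          ≤⟨ *-monoˡ-≤ (2 ^ suc J) t≤c ⟩
    c * 2 ^ suc J                              ≡⟨ φ-root c ⟨
    φ zero c                                   ≤⟨ φc≤ ⟩
    size (λ x → φ x (C x))                     ≤⟨ size-mono (λ x → ≤-trans (φ′-mono (toℕ x) (near? x) (C≤ x)) (φ-extremal x)) ⟩
    size (λ x → at x (fromℕ (suc M)) (T ∸ 1))  ≡⟨ size-at (fromℕ (suc M)) (T ∸ 1) ⟩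
    T ∸ 1                                      <⟨ ≤-reflexive (m+[n∸m]≡n (<⇒≤ 2≤T)) ⟩
    T                                          ∎) (<-irrefl refl)
    where open ≤-Reasoning

-- Upper bound: the scan with its queue of demands.

psum : (ℕ → ℕ) → ℕ → ℕ
psum f zero    = f 0
psum f (suc p) = psum f p + f (suc p)

psum-mono : ∀ f {p q} → p ≤ q → psum f p ≤ psum f q
psum-mono f {p} {q} p≤q = go (≤⇒≤′ p≤q)
  where
  go : ∀ {q} → p ≤′ q → psum f p ≤ psum f q
  go ≤′-refl       = ≤-refl
  go (≤′-step p≤q) = ≤-trans (go p≤q) (m≤m+n _ _)

module Good {n : ℕ} (G : Graph n) (t : ℕ) (r : Fin n) where

  -- Upward closed by definition, so surplus pebbles may be ignored and equalities need only hold
  -- pointwise.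
  Good : Config n → Set
  Good D = ∀ C → (∀ x → D x ≤ C x) → Solvable G t r C

  good-mono : ∀ {D E : Config n} → (∀ x → D x ≤ E x) → Good D → Good E
  good-mono D≤E good C E≤C = good C (λ x → ≤-trans (D≤E x) (E≤C x))

  -- A step read backwards: a demand for one pebble at `w` becomes a demand for two at `u`.
  good-push : ∀ (D : Config n) {u w} → G u w → Good (λ x → D x + at x w 1) → Good (λ x → D x + at x u 2)
  good-push D {u} {w} uw good C ≤C =
    let C' , ⟶C' , t≤ = good (move C u w) (λ x → +-monoˡ-≤ (at x w 1) (m+n≤o⇒m≤o∸n (D x) {at x u 2} (≤C x)))
    in C' , step u w uw 2≤Cu _ (λ _ → refl) ◅ ⟶C' , t≤
    where
    2≤Cu : 2 ≤ C u
    2≤Cu = ≤-trans (≤-reflexive (sym (at-same u 2))) (≤-trans (m≤n+m _ (D u)) (≤C u))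

  -- By `trade-for-root`. It is used where a position has an edge to the root in place of one to
  -- `w`.
  good-redirect : ∀ (D : Config n) {w} → Good (λ x → D x + at x w 1) → Good (λ x → D x + at x r 1)
  good-redirect D {w} good C ≤C =
    let A' , A⟶A' , t≤ = good A (λ x → +-monoˡ-≤ (at x w 1) (m+n≤o⇒m≤o∸n (D x) {at x r 1} (≤C x)))
    in trade-for-root A⟶A' t≤ C w balance
    where
    A : Config n
    A x = (C x ∸ at x r 1) + at x w 1
    balance : ∀ x → A x + at x r 1 ≤ C x + at x w 1
    balance x = ≤-reflexive (trans (+-swap (C x ∸ at x r 1) (at x w 1) (at x r 1))
      (cong (_+ at x w 1) (m∸n+n≡m (m+n≤o⇒n≤o (D x) {at x r 1} (≤C x)))))

module Scan {n : ℕ} (G : Graph n) (t k N B : ℕ) (1≤k : 1 ≤ k) (h : ℕ → Fin n) (c : ℕ → ℕ)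
  (serves : ∀ {w v} → w < v → v ≤ w + k → v ≤ N → G (h v) (h w) ⊎ G (h v) (h 0))
  (B≤total : B ≤ psum c N) where

  open Good G t (h 0)

  scanned : ℕ → Config n
  scanned p x = psum (λ i → at x (h i) (c i)) p

  scanned-mono : ∀ {p q} → p ≤ q → ∀ x → scanned p x ≤ scanned q x
  scanned-mono p≤q x = psum-mono (λ i → at x (h i) (c i)) p≤q

  demand : List ℕ → Config n
  demand []       x = 0
  demand (w ∷ ws) x = at x (h w) 1 + demand ws x

  demand-++ : ∀ xs ys x → demand (xs ++ ys) x ≡ demand xs x + demand ys x
  demand-++ []       ys x = refl
  demand-++ (w ∷ xs) ys x = trans (cong (at x (h w) 1 +_) (demand-++ xs ys x)) (sym (+-assoc (at x (h w) 1) _ _))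

  demand-replicate : ∀ a v x → demand (replicate a v) x ≡ at x (h v) a
  demand-replicate zero    v x with x ≟ h v
  ... | yes _ = refl
  ... | no _  = refl
  demand-replicate (suc a) v x =
    trans (cong (at x (h v) 1 +_) (demand-replicate a v x)) (sym (at-+ x (h v) 1 a))

  serve : ∀ (D : Config n) {w v} → w < v → v ≤ w + k → v ≤ N → Good (λ x → D x + at x (h w) 1) → Good (λ x → D x + at x (h v) 2)
  serve D w<v v≤w+k v≤N good with serves w<v v≤w+k v≤N
  ... | inj₁ vw = good-push D vw good
  ... | inj₂ v0 = good-push D v0 (good-redirect D good)

  -- o pebbles have been scanned up to p and q demands are pending. A worst continuation leaves k j
  -- of the positions between p and N empty, so that every demand doubles j times, and wastes one
  -- pebble on each of the other N - p - 1 - k j; a pile of q 2^(j+1) at N then has to stay within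
  -- the budget B. Both sides are moved so that no subtraction occurs.
  Slack : ℕ → ℕ → ℕ → Set
  Slack o q p = ∀ j → k * j + suc p ≤ N → o + q * 2 ^ suc j + N ≤ B + (k * j + suc p)

  -- Slack at w + k, when the demand at w expires: m counts the pending demands, and once more those
  -- up to and including w, which have then all doubled.
  Bound : ℕ → ℕ → ℕ → Set
  Bound o m w = ∀ j → k * j + suc (w + k) ≤ N → o + m * 2 ^ suc j + N ≤ B + (k * j + suc (w + k))

  -- The multiplier grows along the queue: older demands expire first, and each that doubles adds
  -- one to the number pending.
  Queue : (o m lo hi : ℕ) → List ℕ → Set
  Queue o m lo hi []       = lo ≤ hi
  Queue o m lo hi (w ∷ ws) = lo ≤ w × Bound o m w × Queue o (suc m) w hi ws

  queue-≤ : ∀ {o m lo hi} ws → Queue o m lo hi ws → lo ≤ hi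
  queue-≤ []       lo≤hi              = lo≤hi
  queue-≤ (w ∷ ws) (lo≤w , _ , queue) = ≤-trans lo≤w (queue-≤ ws queue)

  bound-mono : ∀ o {o'} m {m' w} → (∀ j → o' + m' * 2 ^ suc j ≤ o + m * 2 ^ suc j) → Bound o m w → Bound o' m' w
  bound-mono o m le bound j within = ≤-trans (+-monoˡ-≤ N (le j)) (bound j within)

  trade-pebble : ∀ o m j → suc o + m * 2 ^ suc j ≤ o + suc m * 2 ^ suc j
  trade-pebble o m j = begin
    suc o + m * 2 ^ suc j              ≡⟨ +-suc o _ ⟨
    o + (1 + m * 2 ^ suc j)            ≤⟨ +-monoʳ-≤ o (+-monoˡ-≤ _ (m^n>0 2 (suc j))) ⟩
    o + suc m * 2 ^ suc j              ∎
    where open ≤-Reasoning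

  -- A demand weighs `2 ^ suc j`, at least as much as the two pebbles that serve it.
  trade-pair : ∀ o q j → 2 + o + q * 2 ^ suc j ≤ o + suc q * 2 ^ suc j
  trade-pair o q j = begin
    2 + o + q * 2 ^ suc j              ≡⟨ rearr o _ ⟩
    o + (2 + q * 2 ^ suc j)            ≤⟨ +-monoʳ-≤ o (+-monoˡ-≤ _ (*-monoʳ-≤ 2 (m^n>0 2 j))) ⟩
    o + suc q * 2 ^ suc j              ∎
    where
    open ≤-Reasoning
    rearr : ∀ a b → 2 + a + b ≡ a + (2 + b)
    rearr = solve-∀

  queue-trade : ∀ {o m lo hi} ws → Queue o (suc m) lo hi ws → Queue (suc o) m lo hi ws
  queue-trade             []       lo≤hi = lo≤hi
  queue-trade {o = o} {m} (w ∷ ws) (lo≤w , bound , queue) =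
    lo≤w , bound-mono o (suc m) {m' = m} (trade-pebble o m) bound , queue-trade ws queue

  -- Letting all `q` demands double over the next `k` positions is the passage from `j` to `suc j`
  -- in `Slack`.
  slack-doubled : ∀ {o v m} q → Slack o q v → m ≤ q + q → Bound o m v
  slack-doubled {o} {v} {m} q slack m≤ j within = begin
    o + m * 2 ^ suc j + N               ≤⟨ +-monoˡ-≤ N (+-monoʳ-≤ o (*-monoˡ-≤ (2 ^ suc j) m≤)) ⟩
    o + (q + q) * 2 ^ suc j + N         ≡⟨ cong (λ a → o + a + N) (twice q (2 ^ suc j)) ⟩
    o + q * 2 ^ suc (suc j) + N         ≤⟨ slack (suc j) (≤-trans (≤-reflexive (sym (shift k j v))) within) ⟩
    B + (k * suc j + suc v)             ≡⟨ cong (B +_) (shift k j v) ⟨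
    B + (k * j + suc (v + k))           ∎
    where
    open ≤-Reasoning
    twice : ∀ q P → (q + q) * P ≡ q * (2 * P)
    twice = solve-∀
    shift : ∀ k j v → k * j + suc (v + k) ≡ k * suc j + suc v
    shift k j v = trans (lemma (k * j) v k) (cong (_+ suc v) (sym (*-suc k j)))
      where
      lemma : ∀ a v k → a + suc (v + k) ≡ (k + a) + suc v
      lemma = solve-∀

  -- By the time the new demands at `v` have expired, each of the `q` pending ones has doubled at
  -- most once, so no multiplier needs to exceed `q + q`.
  queue-replicate : ∀ {o m lo v} q a → lo ≤ v → Slack o q v → m + a ≤ suc (q + q) →
                    Queue o m lo v (replicate a v)
  queue-replicate q zero    lo≤v slack m≤ = lo≤v
  queue-replicate {o} {m} q (suc a) lo≤v slack m≤ =
    lo≤v , slack-doubled q slack (≤-trans (m≤m+n m a) (s≤s⁻¹ m+a<)) , queue-replicate q a ≤-refl slack m+a<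
    where
    m+a< : suc m + a ≤ suc (q + q)
    m+a< = ≤-trans (≤-reflexive (sym (+-suc m a))) m≤

  queue-append : ∀ {o m lo p v} q xs a → p ≤ v → Slack o q v → m + (length xs + a) ≤ suc (q + q) →
                 Queue o m lo p xs → Queue o m lo v (xs ++ replicate a v)
  queue-append q []       a p≤v slack m≤ lo≤p = queue-replicate q a (≤-trans lo≤p p≤v) slack m≤
  queue-append {m = m} q (w ∷ xs) a p≤v slack m≤ (lo≤w , bound , queue) =
    lo≤w , bound , queue-append q xs a p≤v slack (≤-trans (≤-reflexive (sym (+-suc m _))) m≤) queue

  -- The invariant after position `p`. The multiplier starts at one more than the queue length
  -- because the first expiry trades one demand for two. `deadline` keeps every demand within reach
  -- of the next position.
  record State (p : ℕ) : Set where
    field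
      ws       : List ℕ
      lo       : ℕ
      good     : Good (λ x → scanned p x + demand ws x)
      slack    : Slack (psum c p) (length ws) p
      queue    : Queue (psum c p) (suc (length ws)) lo p ws
      deadline : suc p ≤ lo + k

  -- `e` pebbles are asked of position `suc p`; those exceeding its pile turn into new demands
  -- there.
  Pending : (p e : ℕ) → List ℕ → Set
  Pending p e xs = Good (λ x → scanned p x + (demand xs x + at x (h (suc p)) e))

  pending-serve : ∀ {p e w} xs → suc p ≤ N → w ≤ p → suc p ≤ w + k → Pending p e (w ∷ xs) → Pending p (2 + e) xs
  pending-serve {p} {e} {w} xs p<N w≤p p<w+k good =
    good-mono (λ x → ≤-reflexive (after x))
      (serve (λ x → scanned p x + (demand xs x + at x (h (suc p)) e)) (s≤s w≤p) p<w+k p<N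
        (good-mono (λ x → ≤-reflexive (before (scanned p x) (at x (h w) 1) (demand xs x) _)) good))
    where
    before : ∀ a b c d → a + ((b + c) + d) ≡ a + (c + d) + b
    before = solve-∀
    rearr : ∀ a b c d → a + (b + c) + d ≡ a + (b + (d + c))
    rearr = solve-∀
    after : ∀ x → scanned p x + (demand xs x + at x (h (suc p)) e) + at x (h (suc p)) 2
                ≡ scanned p x + (demand xs x + at x (h (suc p)) (2 + e))
    after x = trans (rearr (scanned p x) (demand xs x) (at x (h (suc p)) e) (at x (h (suc p)) 2))
                    (cong (λ a → scanned p x + (demand xs x + a)) (sym (at-+ x (h (suc p)) 2 e)))

  pending-done : ∀ {p e} → suc p ≤ N → e ≤ c (suc p) → Pending p e [] → Good (scanned N)
  pending-done {p} p<N e≤c = good-mono λ x →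
    ≤-trans (+-monoʳ-≤ (scanned p x) (at-mono x (h (suc p)) e≤c)) (scanned-mono p<N x)

  module _ {p : ℕ} (p<N : suc p ≤ N) (next : State (suc p) → Good (scanned N)) where

    private
      v = suc p

    -- Nothing is due at `v` any longer, so the `a` new demands join the end of the queue.
    settle : ∀ xs a {lo} → Pending p (c v + a) xs → Slack (psum c v) (length xs + a) v →
             Queue (psum c v) (suc (length xs + a)) lo p xs → v < lo + k → Good (scanned N)
    settle xs a {lo} pending slack queue v<lo+k = next (record
      { ws       = xs ++ replicate a v
      ; lo       = lo
      ; good     = good-mono (λ x → ≤-reflexive (regroup x)) pending
      ; slack    = subst (λ q → Slack (psum c v) q v) (sym len) slack
      ; queue    = subst (λ q → Queue (psum c v) (suc q) lo v (xs ++ replicate a v)) (sym len)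
                     (queue-append (length xs + a) xs a (n≤1+n p) slack ≤-refl queue)
      ; deadline = v<lo+k })
      where
      len : length (xs ++ replicate a v) ≡ length xs + a
      len = trans (length-++ xs) (cong (length xs +_) (length-replicate a))
      rearr : ∀ a b c d → a + (b + (c + d)) ≡ (a + c) + (b + d)
      rearr = solve-∀
      regroup : ∀ x → scanned p x + (demand xs x + at x (h v) (c v + a))
                    ≡ scanned v x + demand (xs ++ replicate a v) x
      regroup x = trans (cong (λ b → scanned p x + (demand xs x + b)) (at-+ x (h v) (c v) a))
        (trans (rearr (scanned p x) (demand xs x) (at x (h v) (c v)) (at x (h v) a))
          (cong (scanned v x +_) (sym (trans (demand-++ xs (replicate a v) x)
            (cong (demand xs x +_) (demand-replicate a v x))))))

    -- Lets the demands at `v - k` expire one by one; as the queue is sorted, they are at its front.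
    double : ∀ xs a {lo} → Pending p (c v + a) xs → Slack (psum c v) (length xs + a) v →
             Queue (psum c v) (suc (length xs + a)) lo p xs → v ≤ lo + k → Good (scanned N)
    double [] a pending slack queue v≤ = next (record
      { ws       = replicate a v
      ; lo       = v
      ; good     = good-mono (λ x → ≤-reflexive (regroup x)) pending
      ; slack    = subst (λ q → Slack (psum c v) q v) (sym (length-replicate a)) slack
      ; queue    = subst (λ q → Queue (psum c v) (suc q) v v (replicate a v)) (sym (length-replicate a))
                     (queue-replicate a a ≤-refl slack ≤-refl)
      ; deadline = m<m+n v 1≤k })
      where
      regroup : ∀ x → scanned p x + (0 + at x (h v) (c v + a)) ≡ scanned v x + demand (replicate a v) x
      regroup x = trans (cong (scanned p x +_) (at-+ x (h v) (c v) a))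
        (trans (sym (+-assoc (scanned p x) _ _)) (cong (scanned v x +_) (sym (demand-replicate a v x))))
    double (w ∷ xs) a {lo} pending slack (lo≤w , bound , queue) v≤ with m≤n⇒m<n∨m≡n (≤-trans v≤ (+-monoˡ-≤ k lo≤w))
    ... | inj₁ v<w+k = settle (w ∷ xs) a pending slack (≤-refl , bound , queue) v<w+k
    ... | inj₂ v≡w+k = double xs (2 + a)
            (subst (λ e → Pending p e xs) (e-eq (c v) a)
              (pending-serve xs p<N (queue-≤ xs queue) (≤-reflexive v≡w+k) pending))
            -- The bound stored with `w` is the slack at `w + k = v` once `w` has been replaced by
            -- two demands.
            (subst₂ (λ q u → Slack (psum c v) q u) q-eq (sym v≡w+k) bound)
            (subst (λ q → Queue (psum c v) (suc q) w p xs) q-eq queue)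
            (≤-reflexive v≡w+k)
      where
      e-eq : ∀ b a → 2 + (b + a) ≡ b + (2 + a)
      e-eq = solve-∀
      q-eq : 2 + (length xs + a) ≡ length xs + (2 + a)
      q-eq = e-eq (length xs) a

    -- Of the pile at `v`, `s` pebbles are spent and `c'` remain; `o` counts all earlier pebbles and
    -- the spent ones.
    serveAll : ∀ c' s o xs {lo} → s + c' ≡ c v → o + c' ≡ psum c v → Pending p s xs →
               Slack o (length xs) p → Queue o (suc (length xs)) lo p xs → v ≤ lo + k → Good (scanned N)
    serveAll zero s o xs {lo} s≡ o≡ pending slack queue v≤ =
      double xs 0 (subst (λ e → Pending p e xs) s≡′ pending)
        (subst₂ (λ o q → Slack o q v) o≡′ (sym (+-identityʳ (length xs))) slack′)
        (subst₂ (λ o q → Queue o (suc q) lo p xs) o≡′ (sym (+-identityʳ (length xs))) queue) v≤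
      where
      s≡′ : s ≡ c v + 0
      s≡′ = trans (sym (+-identityʳ s)) (trans s≡ (sym (+-identityʳ (c v))))
      o≡′ : o ≡ psum c v
      o≡′ = trans (sym (+-identityʳ o)) o≡
      slack′ : Slack o (length xs) v
      slack′ j within = ≤-trans (slack j (≤-trans (+-monoʳ-≤ (k * j) (n≤1+n v)) within))
                                (+-monoʳ-≤ B (+-monoʳ-≤ (k * j) (n≤1+n v)))
    serveAll (suc c') s o [] s≡ o≡ pending slack queue v≤ =
      pending-done p<N (≤-trans (m≤m+n s (suc c')) (≤-reflexive s≡)) pending
    -- The leftover pebble covers one of the two that `w` asks of `v`, so one demand remains. In
    -- `Slack` the advance of the position pays for this pebble; in the queue each multiplier drops
    -- by one, as `w` no longer doubles.
    serveAll (suc zero) s o (w ∷ xs) {lo} s≡ o≡ pending slack (lo≤w , bound , queue) v≤ =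
      double xs 1 (subst (λ e → Pending p e xs) e-eq (pending-serve xs p<N (queue-≤ xs queue) v≤w+k pending))
        (subst₂ (λ o q → Slack o q v) o≡′ (sym (+-comm (length xs) 1)) slack′)
        (subst₂ (λ o q → Queue o (suc q) w p xs) o≡′ (sym (+-comm (length xs) 1)) (queue-trade xs queue)) v≤w+k
      where
      v≤w+k : v ≤ w + k
      v≤w+k = ≤-trans v≤ (+-monoˡ-≤ k lo≤w)
      e-eq : 2 + s ≡ c v + 1
      e-eq = trans (rearr s) (cong (_+ 1) s≡)
        where
        rearr : ∀ s → 2 + s ≡ s + 1 + 1
        rearr = solve-∀
      o≡′ : suc o ≡ psum c v
      o≡′ = trans (+-comm 1 o) o≡
      slack′ : Slack (suc o) (suc (length xs)) v
      slack′ j within = ≤-trans (s≤s (slack j (≤-trans (+-monoʳ-≤ (k * j) (n≤1+n v)) within)))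
        (≤-reflexive (rearr B (k * j) v))
        where
        rearr : ∀ B a v → suc (B + (a + v)) ≡ B + (a + suc v)
        rearr = solve-∀
    serveAll (suc (suc c')) s o (w ∷ xs) {lo} s≡ o≡ pending slack (lo≤w , bound , queue) v≤ =
      serveAll c' (2 + s) (2 + o) xs (trans (rearr s c') s≡) (trans (rearr o c') o≡)
        (pending-serve xs p<N (queue-≤ xs queue) v≤w+k pending)
        (λ j within → ≤-trans (+-monoˡ-≤ N (trade-pair o (length xs) j)) (slack j within))
        -- The served demand is neither pending nor going to double, so each later multiplier drops
        -- by two, one for each pebble of the pair.
        (queue-trade xs (queue-trade xs queue)) v≤w+k
      where
      v≤w+k : v ≤ w + k
      v≤w+k = ≤-trans v≤ (+-monoˡ-≤ k lo≤w)
      rearr : ∀ a b → 2 + a + b ≡ a + (2 + b)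
      rearr = solve-∀

  state⇒pending : ∀ {p} (s : State p) → Pending p 0 (State.ws s)
  state⇒pending {p} s = good-mono (λ x → +-monoʳ-≤ (scanned p x) (m≤m+n _ _)) (State.good s)

  serveWithPairs : ∀ {p} → suc p ≤ N → ∀ xs e {o m lo} → Pending p e xs → e + 2 * length xs ≤ c (suc p) →
                   Queue o m lo p xs → suc p ≤ lo + k → Good (scanned N)
  serveWithPairs p<N [] e pending e≤ queue p≤ = pending-done p<N (m+n≤o⇒m≤o e e≤) pending
  serveWithPairs p<N (w ∷ xs) e pending e≤ (lo≤w , bound , queue) p≤ =
    serveWithPairs p<N xs (2 + e) (pending-serve xs p<N (queue-≤ xs queue) p≤′ pending)
      (≤-trans (≤-reflexive (rearr e (length xs))) e≤) queue p≤′
    where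
    p≤′ = ≤-trans p≤ (+-monoˡ-≤ k lo≤w)
    rearr : ∀ e l → 2 + e + 2 * l ≡ e + 2 * suc l
    rearr = solve-∀

  scan : ∀ y {p} → p + suc y ≡ N → State p → Good (scanned N)
  scan zero {p} p+1≡N s = serveWithPairs (≤-reflexive v≡N) ws 0 (state⇒pending s) enough queue deadline
    where
    open State s
    open ≤-Reasoning
    v≡N : suc p ≡ N
    v≡N = trans (+-comm 1 p) p+1≡N
    enough : 2 * length ws ≤ c (suc p)
    -- Slack at `j = 0` with only position `N` left: two pebbles per pending demand fit into what
    -- `B` leaves for the last pile.
    enough = +-cancelˡ-≤ (psum c p + N) _ _ (begin
      psum c p + N + 2 * length ws     ≡⟨ rearr (psum c p) N (length ws) ⟩
      psum c p + length ws * 2 + N     ≤⟨ slack 0 (≤-reflexive at-end) ⟩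
      B + (k * 0 + suc p)              ≡⟨ cong (B +_) at-end ⟩
      B + N                            ≤⟨ +-monoˡ-≤ N (≤-trans B≤total (≤-reflexive (cong (psum c) (sym v≡N)))) ⟩
      psum c p + c (suc p) + N         ≡⟨ +-swap (psum c p) (c (suc p)) N ⟩
      psum c p + N + c (suc p)         ∎)
      where
      at-end : k * 0 + suc p ≡ N
      at-end = trans (cong (_+ suc p) (*-zeroʳ k)) v≡N
      rearr : ∀ a N l → a + N + 2 * l ≡ a + l * 2 + N
      rearr = solve-∀
  scan (suc y) {p} p+y≡N s = serveAll p<N (scan y (trans (sym (+-suc p (suc y))) p+y≡N)) (c (suc p)) 0 (psum c p) ws
    refl refl (state⇒pending s) slack queue deadline
    where
    open State s
    p<N : suc p ≤ N
    p<N = ≤-trans (s≤s (m≤m+n p (suc y))) (≤-reflexive (trans (sym (+-suc p (suc y))) p+y≡N))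

  scan-from-root : 1 ≤ N → (∀ j → k * j + 1 ≤ N → t * 2 ^ suc j + N ≤ B + (k * j + 1)) → Good (scanned N)
  scan-from-root 1≤N budget with t ≤? c 0
  ... | yes t≤c = λ C ≤C → C , ε , ≤-trans t≤c (≤-trans (≤-reflexive (sym (at-same (h 0) (c 0))))
                    (≤-trans (scanned-mono {0} {N} z≤n (h 0)) (≤C (h 0))))
  ... | no t≰c = scan (N ∸ 1) (m+[n∸m]≡n 1≤N) (record
        { ws       = replicate a 0
        ; lo       = 0
        ; good     = λ C ≤C → C , ε , ≤-trans (≤-reflexive (at-root)) (≤C (h 0))
        ; slack    = subst (λ q → Slack (c 0) q 0) (sym (length-replicate a)) slack
        ; queue    = subst (λ q → Queue (c 0) (suc q) 0 0 (replicate a 0)) (sym (length-replicate a))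
                       (queue-replicate a a ≤-refl slack ≤-refl)
        ; deadline = 1≤k })
    where
    a : ℕ
    a = t ∸ c 0
    c+a≡t : c 0 + a ≡ t
    c+a≡t = m+[n∸m]≡n (<⇒≤ (≰⇒> t≰c))
    at-root : t ≡ at (h 0) (h 0) (c 0) + demand (replicate a 0) (h 0)
    at-root = sym (trans (cong₂ _+_ (at-same (h 0) (c 0)) (trans (demand-replicate a 0 (h 0)) (at-same (h 0) a))) c+a≡t)
    slack : Slack (c 0) a 0
    slack j within = ≤-trans (+-monoˡ-≤ N (begin
      -- Pebbles already on the root are charged like the demands they meet.
      c 0 + a * 2 ^ suc j               ≤⟨ +-monoˡ-≤ _ (m≤m*n (c 0) (2 ^ suc j) {{m^n≢0 2 (suc j)}}) ⟩
      c 0 * 2 ^ suc j + a * 2 ^ suc j   ≡⟨ *-distribʳ-+ (2 ^ suc j) (c 0) a ⟨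
      (c 0 + a) * 2 ^ suc j             ≡⟨ cong (_* 2 ^ suc j) c+a≡t ⟩
      t * 2 ^ suc j                     ∎)) (budget j within)
      where open ≤-Reasoning

-- Listing the vertices from the root.

size≡vsum : ∀ {n} (C : Config n) → size C ≡ vsum C
size≡vsum {zero}  C = refl
size≡vsum {suc n} C = cong (C zero +_) (size≡vsum (C ∘ suc))

size-permute : ∀ {n} (C : Config n) (π : Permutation n n) → size (λ i → C (π ⟨$⟩ʳ i)) ≡ size C
size-permute C π = trans (size≡vsum (λ i → C (π ⟨$⟩ʳ i))) (trans (sym (sum-permute C π)) (sym (size≡vsum C)))

psum-suc : ∀ f p → psum f (suc p) ≡ f 0 + psum (f ∘ suc) p
psum-suc f zero    = refl
psum-suc f (suc p) = trans (cong (_+ f (2 + p)) (psum-suc f p)) (+-assoc (f 0) _ _)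

psum≡size : ∀ f N → psum f N ≡ size {suc N} (f ∘ toℕ)
psum≡size f zero    = sym (+-identityʳ (f 0))
psum≡size f (suc N) = trans (psum-suc f N) (cong (f 0 +_) (psum≡size (f ∘ suc) N))

∣m-n∣-bounds : ∀ {m n k} → m < n → n ≤ m + k → 1 ≤ ∣ m - n ∣ × ∣ m - n ∣ ≤ k
∣m-n∣-bounds {m} {n} {k} m<n n≤m+k rewrite m≤n⇒∣m-n∣≡n∸m (<⇒≤ m<n) = m<n⇒0<n∸m m<n , m≤n+o⇒m∸n≤o n m n≤m+k

edge : ∀ {n k} {a b : Fin n} → toℕ a < toℕ b → toℕ b ≤ toℕ a + k → Pk n k a b
edge = ∣m-n∣-bounds

edge˘ : ∀ {n k} {a b : Fin n} → toℕ a < toℕ b → toℕ b ≤ toℕ a + k → Pk n k b a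
edge˘ {n} {k} {a} {b} a<b b≤a+k = subst (λ d → 1 ≤ d × d ≤ k) (∣-∣-comm (toℕ a) (toℕ b)) (∣m-n∣-bounds a<b b≤a+k)

-- First the root and the vertices after it, then those before it, nearest first. This makes the
-- distance along the line from the second part to the first an overestimate of that to the root.
module Line (N k : ℕ) (r : Fin (suc N)) where

  ρ m : ℕ
  ρ = toℕ r
  m = N ∸ ρ

  ρ≤N : ρ ≤ N
  ρ≤N = toℕ≤pred[n] r

  ρ+m≡N : ρ + m ≡ N
  ρ+m≡N = m+[n∸m]≡n ρ≤N

  line : ℕ → ℕ
  line p with p ≤? m
  ... | yes _ = ρ + p
  ... | no  _ = N ∸ p

  line-near : ∀ {p} → p ≤ m → line p ≡ ρ + p
  line-near {p} p≤m with p ≤? m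
  ... | yes _  = refl
  ... | no p≰m = contradiction p≤m p≰m

  line-far : ∀ {p} → m < p → line p ≡ N ∸ p
  line-far {p} m<p with p ≤? m
  ... | yes p≤m = contradiction (<-≤-trans m<p p≤m) (<-irrefl refl)
  ... | no _    = refl

  line≤N : ∀ p → line p ≤ N
  line≤N p with p ≤? m
  ... | yes p≤m = ≤-trans (+-monoʳ-≤ ρ p≤m) (≤-reflexive ρ+m≡N)
  ... | no _    = m∸n≤m N p

  h : ℕ → Fin (suc N)
  h p = fromℕ< (s≤s (line≤N p))

  toℕ-h : ∀ p → toℕ (h p) ≡ line p
  toℕ-h p = toℕ-fromℕ< (s≤s (line≤N p))

  toℕ-h-near : ∀ {p} → p ≤ m → toℕ (h p) ≡ ρ + p
  toℕ-h-near {p} p≤m = trans (toℕ-h p) (line-near p≤m)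

  toℕ-h-far : ∀ {p} → m < p → toℕ (h p) ≡ N ∸ p
  toℕ-h-far {p} m<p = trans (toℕ-h p) (line-far m<p)

  h-root : h 0 ≡ r
  h-root = toℕ-injective (trans (toℕ-h-near z≤n) (+-identityʳ ρ))

  far<ρ : ∀ {p} → m < p → p ≤ N → N ∸ p < ρ
  far<ρ {p} m<p p≤N = +-cancelʳ-< p (N ∸ p) ρ (begin-strict
    N ∸ p + p   ≡⟨ m∸n+n≡m p≤N ⟩
    N           ≡⟨ ρ+m≡N ⟨
    ρ + m       <⟨ +-monoʳ-< ρ m<p ⟩
    ρ + p       ∎)
    where open ≤-Reasoning

  pos : Fin (suc N) → ℕ
  pos v with ρ ≤? toℕ v
  ... | yes _ = toℕ v ∸ ρ
  ... | no  _ = N ∸ toℕ v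

  pos≤N : ∀ v → pos v ≤ N
  pos≤N v with ρ ≤? toℕ v
  ... | yes _ = ≤-trans (m∸n≤m (toℕ v) ρ) (toℕ≤pred[n] v)
  ... | no  _ = m∸n≤m N (toℕ v)

  line-pos : ∀ v → line (pos v) ≡ toℕ v
  line-pos v with ρ ≤? toℕ v
  ... | yes ρ≤v = trans (line-near (∸-monoˡ-≤ ρ (toℕ≤pred[n] v))) (m+[n∸m]≡n ρ≤v)
  ... | no ρ≰v  = trans (line-far (∸-monoʳ-< (≰⇒> ρ≰v) ρ≤N)) (m∸[m∸n]≡n (toℕ≤pred[n] v))

  pos-after : ∀ {v} → ρ ≤ toℕ v → pos v ≡ toℕ v ∸ ρ
  pos-after {v} ρ≤v with ρ ≤? toℕ v
  ... | yes _  = refl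
  ... | no ρ≰v = contradiction ρ≤v ρ≰v

  pos-before : ∀ {v} → toℕ v < ρ → pos v ≡ N ∸ toℕ v
  pos-before {v} v<ρ with ρ ≤? toℕ v
  ... | yes ρ≤v = contradiction (<-≤-trans v<ρ ρ≤v) (<-irrefl refl)
  ... | no _    = refl

  pos-line : ∀ p → p ≤ N → pos (h p) ≡ p
  pos-line p p≤N = split (≤-<-connex p m)
    where
    split : p ≤ m ⊎ m < p → pos (h p) ≡ p
    split (inj₁ p≤m) = trans (pos-after (≤-trans (m≤m+n ρ p) (≤-reflexive (sym (toℕ-h-near p≤m)))))
                             (trans (cong (_∸ ρ) (toℕ-h-near p≤m)) (m+n∸m≡n ρ p))
    split (inj₂ m<p) = trans (pos-before (≤-<-trans (≤-reflexive (toℕ-h-far m<p)) (far<ρ m<p p≤N)))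
                             (trans (cong (N ∸_) (toℕ-h-far m<p)) (m∸[m∸n]≡n p≤N))

  π : Permutation (suc N) (suc N)
  π = permutation (h ∘ toℕ) (λ v → fromℕ< (s≤s (pos≤N v)))
    (λ v → toℕ-injective (trans (toℕ-h (toℕ (fromℕ< (s≤s (pos≤N v))))) (trans (cong line (toℕ-fromℕ< (s≤s (pos≤N v)))) (line-pos v))))
    (λ i → toℕ-injective (trans (toℕ-fromℕ< (s≤s (pos≤N (h (toℕ i))))) (pos-line (toℕ i) (toℕ≤pred[n] i))))

  psum-line : ∀ (C : Config (suc N)) → psum (C ∘ h) N ≡ size C
  psum-line C = trans (psum≡size (C ∘ h) N) (size-permute C π)

  serves : ∀ {w v} → w < v → v ≤ w + k → v ≤ N → Pk (suc N) k (h v) (h w) ⊎ Pk (suc N) k (h v) (h 0)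
  serves {w} {v} w<v v≤w+k v≤N with ≤-<-connex w m | ≤-<-connex v m
  ... | inj₁ w≤m | inj₁ v≤m = inj₁ (edge˘
    (subst₂ _<_ (sym (toℕ-h-near w≤m)) (sym (toℕ-h-near v≤m)) (+-monoʳ-< ρ w<v))
    (subst₂ (λ a b → b ≤ a + k) (sym (toℕ-h-near w≤m)) (sym (toℕ-h-near v≤m))
      (≤-trans (+-monoʳ-≤ ρ v≤w+k) (≤-reflexive (sym (+-assoc ρ w k))))))
  ... | inj₂ m<w  | inj₁ v≤m = contradiction (<-≤-trans m<w (≤-trans (<⇒≤ w<v) v≤m)) (<-irrefl refl)
  -- The vertex at `v` lies `v - m` before the root, which is at most `v - w` and hence at most `k`.
  ... | inj₁ w≤m | inj₂ m<v  = inj₂ (edge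
    (subst₂ _<_ (sym (toℕ-h-far m<v)) (sym (cong toℕ h-root)) (far<ρ m<v v≤N))
    (subst₂ (λ a b → b ≤ a + k) (sym (toℕ-h-far m<v)) (sym (cong toℕ h-root))
      (+-cancelʳ-≤ v _ _ (begin
        ρ + v               ≤⟨ +-monoʳ-≤ ρ (≤-trans v≤w+k (+-monoˡ-≤ k w≤m)) ⟩
        ρ + (m + k)         ≡⟨ +-assoc ρ m k ⟨
        ρ + m + k           ≡⟨ cong (_+ k) (trans ρ+m≡N (sym (m∸n+n≡m v≤N))) ⟩
        N ∸ v + v + k       ≡⟨ +-swap (N ∸ v) v k ⟩
        N ∸ v + k + v       ∎))))
    where
    open ≤-Reasoning
  ... | inj₂ m<w  | inj₂ m<v  = inj₁ (edge
    (subst₂ _<_ (sym (toℕ-h-far m<v)) (sym (toℕ-h-far m<w)) (∸-monoʳ-< w<v v≤N))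
    (subst₂ (λ a b → b ≤ a + k) (sym (toℕ-h-far m<v)) (sym (toℕ-h-far m<w))
      (m≤n+o⇒m∸n≤o N w (begin
        N                   ≡⟨ m+[n∸m]≡n v≤N ⟨
        v + (N ∸ v)         ≤⟨ +-monoˡ-≤ (N ∸ v) v≤w+k ⟩
        w + k + (N ∸ v)     ≡⟨ rearr w k (N ∸ v) ⟩
        w + (N ∸ v + k)     ∎))))
    where
    open ≤-Reasoning
    rearr : ∀ a b c → a + b + c ≡ a + (c + b)
    rearr = solve-∀

  allSolvable : ∀ {t B} → 1 ≤ k → 1 ≤ N → (∀ j → k * j + 1 ≤ N → t * 2 ^ suc j + N ≤ B + (k * j + 1)) →
                AllSolvable (Pk (suc N) k) t r B
  allSolvable {t} {B} 1≤k 1≤N budget C size≡B =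
    subst (λ r → Solvable (Pk (suc N) k) t r C) h-root
      (scan-from-root 1≤N budget C (λ x → ≤-reflexive (scanned≡C x)))
    where
    open Scan (Pk (suc N) k) t k N B 1≤k h (C ∘ h) serves (≤-reflexive (trans (sym size≡B) (sym (psum-line C))))
    -- Turns the sum over `v` into that of a point mass at `x`, to which `size-at` applies.
    at-diagonal : ∀ x v → at x v (C v) ≡ at v x (C x)
    at-diagonal x v with x ≟ v | v ≟ x
    ... | yes refl | yes _  = refl
    ... | yes refl | no x≢x = contradiction refl x≢x
    ... | no x≢x | yes refl = contradiction refl x≢x
    ... | no _     | no _   = refl
    scanned≡C : ∀ x → scanned N x ≡ C x
    scanned≡C x = begin
      scanned N x                     ≡⟨ psum-line (λ v → at x v (C v)) ⟩
      size (λ v → at x v (C v))       ≡⟨ size-cong (at-diagonal x) ⟩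
      size (λ v → at v x (C x))       ≡⟨ size-at x (C x) ⟩
      C x                             ∎
      where open ≡-Reasoning

-- Convexity in the number of doublings, and the theorem.

steep : ∀ {k t} j i → k ≤ t * 2 ^ j → t * 2 ^ suc j + k * i ≤ t * 2 ^ suc (j + i)
steep {k} {t} j zero    k≤ = ≤-reflexive (trans (cong (t * 2 ^ suc j +_) (*-zeroʳ k))
  (trans (+-identityʳ _) (cong (λ e → t * 2 ^ suc e) (sym (+-identityʳ j)))))
steep {k} {t} j (suc i) k≤ = begin
  t * 2 ^ suc j + k * suc i                          ≡⟨ rearr (t * 2 ^ suc j) k i ⟩
  -- The last doubling adds `t * 2 ^ suc (j + i)`, at least `t * 2 ^ j` and so at least `k`.
  (t * 2 ^ suc j + k * i) + k                        ≤⟨ +-mono-≤ (steep {k} {t} j i k≤) (≤-trans k≤ (*-monoʳ-≤ t (^-monoʳ-≤ 2 (m≤n⇒m≤1+n (m≤m+n j i))))) ⟩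
  t * 2 ^ suc (j + i) + t * 2 ^ suc (j + i)          ≡⟨ twice t (2 ^ suc (j + i)) ⟩
  t * 2 ^ suc (suc (j + i))                          ≡⟨ cong (λ e → t * 2 ^ suc e) (+-suc j i) ⟨
  t * 2 ^ suc (j + suc i)                            ∎
  where
  open ≤-Reasoning
  rearr : ∀ a k i → a + k * suc i ≡ a + k * i + k
  rearr = solve-∀
  twice : ∀ t P → t * P + t * P ≡ t * (2 * P)
  twice = solve-∀

-- Up to `j` every doubling adds at most `t * 2 ^ j`, hence at most `k`.
flat : ∀ {k} t j → t * 2 ^ j ≤ k → t * 2 ^ suc j ≤ 2 * t + k * j
flat {k} t zero    t≤ = ≤-reflexive (trans (*-comm t 2) (sym (trans (cong (2 * t +_) (*-zeroʳ k)) (+-identityʳ _))))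
flat {k} t (suc j) t≤ = begin
  t * 2 ^ suc (suc j)                  ≡⟨ twice t (2 ^ suc j) ⟨
  t * 2 ^ suc j + t * 2 ^ suc j        ≤⟨ +-mono-≤ (flat t j (≤-trans (*-monoʳ-≤ t (^-monoʳ-≤ 2 (n≤1+n j))) t≤)) t≤ ⟩
  2 * t + k * j + k                    ≡⟨ rearr t k j ⟩
  2 * t + k * suc j                    ∎
  where
  open ≤-Reasoning
  twice : ∀ t P → t * P + t * P ≡ t * (2 * P)
  twice = solve-∀
  rearr : ∀ t k j → 2 * t + k * j + k ≡ 2 * t + k * suc j
  rearr = solve-∀

module _ (t k M : ℕ) .{{_ : NonZero k}} where

  J : ℕ
  J = M / k

  pt≡ : pt t (2 + M) k ≡ (t * 2 ^ suc J + (M ∸ J * k)) ⊔ (2 * t + M)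
  pt≡ = cong₂ _⊔_
    (cong₂ (λ d b → t * 2 ^ d + (M ∸ b)) (+-comm J 1) (trans (cong (k *_) (m+n∸n≡m J 1)) (*-comm k J)))
    (+-∸-assoc (2 * t) {2 + M} (s≤s (s≤s z≤n)))

  -- The left side minus k j is convex in j, so only j = 0 and j = J matter.
  convex-budget : ∀ j → k * j ≤ M → t * 2 ^ suc j + M ≤ pt t (2 + M) k + k * j
  -- Comparing `k` with the increment `t * 2 ^ j` tells on which side of the minimum `j` lies.
  convex-budget j kj≤M rewrite pt≡ with ≤-total k (t * 2 ^ j)
  ... | inj₁ k≤ = ≤-trans (begin
    t * 2 ^ suc j + M                                   ≡⟨ cong (t * 2 ^ suc j +_) (m+[n∸m]≡n (m/n*n≤m M k)) ⟨
    t * 2 ^ suc j + (J * k + (M ∸ J * k))               ≡⟨ cong (λ a → t * 2 ^ suc j + (a + (M ∸ J * k))) J*k≡ ⟩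
    t * 2 ^ suc j + (k * (J ∸ j) + k * j + (M ∸ J * k)) ≡⟨ rearr (t * 2 ^ suc j) (k * (J ∸ j)) (k * j) (M ∸ J * k) ⟩
    t * 2 ^ suc j + k * (J ∸ j) + (M ∸ J * k) + k * j   ≤⟨ +-monoˡ-≤ (k * j) (+-monoˡ-≤ (M ∸ J * k) (steep {k} {t} j (J ∸ j) k≤)) ⟩
    t * 2 ^ suc (j + (J ∸ j)) + (M ∸ J * k) + k * j     ≡⟨ cong (λ e → t * 2 ^ suc e + (M ∸ J * k) + k * j) (m+[n∸m]≡n j≤J) ⟩
    t * 2 ^ suc J + (M ∸ J * k) + k * j                 ∎)
    (+-monoˡ-≤ (k * j) (m≤m⊔n _ (2 * t + M)))
    where
    open ≤-Reasoning
    j≤J : j ≤ J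
    j≤J = ≤-trans (≤-reflexive (trans (sym (m*n/n≡m j k)) (cong (_/ k) (*-comm j k)))) (/-monoˡ-≤ k kj≤M)
    J*k≡ : J * k ≡ k * (J ∸ j) + k * j
    J*k≡ = trans (*-comm J k) (trans (cong (k *_) (sym (m∸n+n≡m j≤J))) (*-distribˡ-+ k (J ∸ j) j))
    rearr : ∀ a b c d → a + (b + c + d) ≡ a + b + d + c
    rearr = solve-∀
  ... | inj₂ ≤k = ≤-trans (begin
    t * 2 ^ suc j + M          ≤⟨ +-monoˡ-≤ M (flat t j ≤k) ⟩
    2 * t + k * j + M          ≡⟨ +-swap (2 * t) (k * j) M ⟩
    2 * t + M + k * j          ∎)
    (+-monoˡ-≤ (k * j) (m≤n⊔m (t * 2 ^ suc J + (M ∸ J * k)) (2 * t + M)))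
    where
    open ≤-Reasoning

  upper : ∀ r → AllSolvable (Pk (2 + M) k) t r (pt t (2 + M) k)
  upper r = Line.allSolvable (suc M) k r (>-nonZero⁻¹ k) (s≤s z≤n) λ j within →
    begin
      t * 2 ^ suc j + suc M            ≡⟨ +-suc _ M ⟩
      suc (t * 2 ^ suc j + M)          ≤⟨ s≤s (convex-budget j (s≤s⁻¹ (≤-trans (≤-reflexive (+-comm 1 (k * j))) within))) ⟩
      suc (pt t (2 + M) k + k * j)     ≡⟨ rearr (pt t (2 + M) k) (k * j) ⟩
      pt t (2 + M) k + (k * j + 1)     ∎
    where
    open ≤-Reasoning
    rearr : ∀ a b → suc (a + b) ≡ a + (b + 1)
    rearr = solve-∀

  lower : 1 ≤ t → ∀ m → m < pt t (2 + M) k → ¬ AllSolvable (Pk (2 + M) k) t zero m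
  -- Each term of the maximum has its own extremal configuration, with parameter `J` or 0.
  lower 1≤t m m< rewrite pt≡ with ⊔-sel (t * 2 ^ suc J + (M ∸ J * k)) (2 * t + M)
  ... | inj₁ eq = LowerBound.¬allSolvable k J M (m/n*n≤m M k) t 1≤t m (≤-trans m< (≤-reflexive eq))
  ... | inj₂ eq = LowerBound.¬allSolvable k 0 M z≤n t 1≤t m
                    (≤-trans m< (≤-reflexive (trans eq (cong (_+ M) (*-comm 2 t)))))

Pk? : ∀ n k (u w : Fin n) → Dec (Pk n k u w)
Pk? n k u w = (1 ≤? ∣ toℕ u - toℕ w ∣) ×-dec (∣ toℕ u - toℕ w ∣ ≤? k)

theorem6 : (n k t : ℕ) → .{{_ : NonZero k}} → 2 ≤ n → 1 ≤ t →
    IsPebblingNumber (Pk n k) t (pt t n k)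
theorem6 (suc (suc M)) k t (s≤s (s≤s z≤n)) 1≤t =
  -- The end vertex 0 attains the value; for an arbitrary root the least size is searched for below
  -- the upper bound.
  (λ r → least (allSolvable? (Pk (2 + M) k) (Pk? (2 + M) k) t r) (upper t k M r)) ,
  zero , upper t k M zero , lower t k M 1≤t
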